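{- Let $\nu$ be a positive integer. For every even integer $r$ with $2\nu\le r\le 2\nu+12\lfloor\nu/3\rfloor$ there exists a strongly regular graph with parameters $(2^{2\nu}-1,\,2^{2\nu-1},\,2^{2\nu-2},\,2^{2\nu-2})$ whose adjacency matrix has 2-rank $r$.
   Context: A strongly regular graph with parameters $(v,k,\lambda,\mu)$ is a $k$-regular graph on $v$ vertices in which any two adjacent vertices have exactly $\lambda$ common neighbours and any two distinct nonadjacent vertices have exactly $\mu$ common neighbours. The 2-rank of the adjacency matrix is its rank over $\mathbb{F}_2$. -}

module Defs where

open import Data.Nat using (ℕ; zero; suc; _+_)
open import Data.Bool using (Bool; true; false; _∧_; _xor_; if_then_else_)
open import Data.Fin using (Fin; zero; suc)
open import Data.Product using (Σ; _×_; ∃)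
open import Relation.Binary.PropositionalEquality using (_≡_; _≢_)
open import Relation.Nullary using (¬_)

-- Elements of the field F₂ are represented by Bool (false = 0, true = 1),
-- addition is xor, multiplication is ∧.

count : ∀ {n} → (Fin n → Bool) → ℕ
count {zero}  f = 0
count {suc n} f = (if f zero then 1 else 0) + count (λ i → f (suc i))

⨁ : ∀ {n} → (Fin n → Bool) → Bool
⨁ {zero}  f = false
⨁ {suc n} f = f zero xor ⨁ (λ i → f (suc i))

record Graph (v : ℕ) : Set where
  field
    adj       : Fin v → Fin v → Bool
    symmetric : ∀ i j → adj i j ≡ adj j i
    loopless  : ∀ i → adj i i ≡ false
open Graph public

degree : ∀ {v} → Graph v → Fin v → ℕ
degree G i = count (λ j → adj G i j)

commonNeighbours : ∀ {v} → Graph v → Fin v → Fin v → ℕ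
commonNeighbours G i j = count (λ k → adj G i k ∧ adj G j k)

IsSRG : (v k l m : ℕ) → Graph v → Set
IsSRG v k l m G =
  (∀ i → degree G i ≡ k) ×
  (∀ i j → adj G i j ≡ true → commonNeighbours G i j ≡ l) ×
  (∀ i j → i ≢ j → adj G i j ≡ false → commonNeighbours G i j ≡ m)

Matrix₂ : ℕ → ℕ → Set
Matrix₂ m n = Fin m → Fin n → Bool

combo : ∀ {m n r} → Matrix₂ m n → (Fin r → Fin m) → (Fin r → Bool) → Fin n → Bool
combo M ρ c j = ⨁ (λ t → c t ∧ M (ρ t) j)

RowsIndependent : ∀ {m n r} → Matrix₂ m n → (Fin r → Fin m) → Set
RowsIndependent M ρ = ∀ c → (∀ j → combo M ρ c j ≡ false) → ∀ t → c t ≡ false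

RowsSpan : ∀ {m n r} → Matrix₂ m n → (Fin r → Fin m) → Set
RowsSpan {m} {n} {r} M ρ = ∀ i → Σ (Fin r → Bool) (λ c → ∀ j → combo M ρ c j ≡ M i j)

Rank₂ : ∀ {m n} → Matrix₂ m n → ℕ → Set
Rank₂ M r = Σ (Fin r → Fin _) (λ ρ → RowsIndependent M ρ × RowsSpan M ρ)

TwoRank : ∀ {v} → Graph v → ℕ → Set
TwoRank G r = Rank₂ (adj G) r

{-# OPTIONS --safe #-}
module Submission where

-- Adjoin an isolated vertex to a strongly regular graph with λ = μ = k/2 and 2k = v + 1: the
-- condition becomes that any two distinct rows of the adjacency matrix N differ in exactly half of
-- the columns, i.e. that the ±1 matrix (-1)^N is Hadamard.  The Kronecker product of Hadamard
-- matrices corresponds to N ⊞ N′ = N ⊗ J + J ⊗ N′, and 2-ranks add: no row space contains the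
-- all-one vector, because of the isolated vertices.  It remains to find one matrix of order 4 (from
-- the triangle, 2-rank 2) and matrices of order 64 and 2-ranks 6, 8, …, 18.  The latter arise from
-- the threefold product of the triangle, which is the complement of the symplectic graph Sp(6,2),
-- by successive Godsil–McKay switchings with respect to 4-sets.

open import Defs
open import Data.Nat using (ℕ; zero; suc; _+_; _*_; _∸_; _^_; _≤_; _/_; _⊓_; z≤n; s≤s)
open import Data.Nat.Divisibility using (_∣_; divides; ∣-refl)
open import Data.Product using (Σ; _×_; _,_; proj₁; proj₂)
open import Data.Nat.DivMod using (+-distrib-/-∣ˡ)
import Data.Nat.Properties as ℕ
open import Data.Nat.Solver using (module +-*-Solver)
open import Data.Bool using (Bool; true; false; _∧_; _xor_; not; if_then_else_)
open import Data.Bool.ListAction using (any; all)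
import Data.Bool.Properties as 𝔹
open import Data.Bool.Solver using (module xor-∧-Solver)
open import Data.Empty using (⊥-elim)
open import Data.Fin
  using (Fin; zero; suc; #_; toℕ; fromℕ<; _↑ˡ_; _↑ʳ_; splitAt; combine; quotient;
    remainder; punchIn; punchOut)
open import Data.Fin.Properties
  using (_≟_; all?; toℕ-fromℕ<; join-splitAt; remQuot-combine; combine-remQuot;
    punchIn-injective; punchIn-punchOut; punchInᵢ≢i)
open import Data.List using (List; []; _∷_; foldl; take; length)
open import Data.List.Properties using (length-take)
open import Data.Sum using (inj₁; inj₂)
open import Data.Vec using (Vec; []; _∷_; lookup; tabulate; zipWith; zip)
open import Data.Vec.Properties using (lookup∘tabulate; lookup-zipWith; lookup-zip)
open import Data.Vec.Relation.Unary.All using (All; []; _∷_)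
import Data.Vec.Relation.Unary.All as All
import Data.Vec.Relation.Unary.All.Properties as Allₚ
open import Data.Vec.Relation.Unary.AllPairs using (AllPairs; []; _∷_; allPairs?)
import Data.Vec.Functional as F
open import Data.Vec.Functional.Properties using (lookup-++ˡ; lookup-++ʳ)
open import Relation.Binary.Definitions using (Symmetric)
open import Relation.Binary.PropositionalEquality
open import Relation.Nullary using (Dec; yes; no)
open import Relation.Nullary.Decidable using (does; toWitness; dec-true; _×-dec_)

-- Counting

count-cong : ∀ {n} {f g : Fin n → Bool} → (∀ i → f i ≡ g i) → count f ≡ count g
count-cong {zero}  f≗g = refl
count-cong {suc n} f≗g =
  cong₂ (λ b k → (if b then 1 else 0) + k) (f≗g zero) (count-cong (λ i → f≗g (suc i)))

count-++ : ∀ m {n} (f : Fin (m + n) → Bool) →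
  count f ≡ count (λ i → f (i ↑ˡ n)) + count (λ j → f (m ↑ʳ j))
count-++ zero    f = refl
count-++ (suc m) f = trans (cong ((if f zero then 1 else 0) +_) (count-++ m (λ i → f (suc i))))
  (sym (ℕ.+-assoc (if f zero then 1 else 0) _ _))

count-complement : ∀ {n} (f : Fin n → Bool) → count f + count (λ i → not (f i)) ≡ n
count-complement {zero}  f = refl
count-complement {suc n} f with f zero | count-complement (λ i → f (suc i))
... | true  | eq = cong suc eq
... | false | eq = trans (ℕ.+-suc _ _) (cong suc eq)

-- Inclusion-exclusion for the symmetric difference. Once all degrees are known, it turns the
-- distance between two rows into their number of common neighbours.
count-xor : ∀ {n} (f g : Fin n → Bool) →
  count (λ i → f i xor g i) + 2 * count (λ i → f i ∧ g i) ≡ count f + count g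
count-xor {zero}  f g = refl
count-xor {suc n} f g
  with f zero | g zero | count-xor (λ i → f (suc i)) (λ i → g (suc i))
... | false | false | eq = eq
... | false | true  | eq = trans (cong suc eq) (sym (ℕ.+-suc _ _))
... | true  | false | eq = cong suc eq
... | true  | true  | eq = trans
  (solve 2 (λ a b → a :+ con 2 :* (con 1 :+ b) := con 2 :+ (a :+ con 2 :* b)) refl
    (count (λ i → f (suc i) xor g (suc i))) _)
  (trans (cong (2 +_) eq) (cong suc (sym (ℕ.+-suc _ _))))
  where open +-*-Solver

count-punchIn : ∀ {n} (o : Fin (suc n)) (f : Fin (suc n) → Bool) → f o ≡ false →
  count (λ i → f (punchIn o i)) ≡ count f
count-punchIn zero f fo rewrite fo = refl
count-punchIn {suc n} (suc o) f fo =
  cong ((if f zero then 1 else 0) +_) (count-punchIn o (λ i → f (suc i)) fo)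

-- A sum over F₂ is 1 where exactly one summand is. `h` is tied to `f` and `g` only by an equation,
-- so that the recursion on `m` can pass to the restriction of `h` after splitting off one block of
-- length `n`.
count-combine : ∀ m {n} (h : Fin (m * n) → Bool) (f : Fin m → Bool) (g : Fin n → Bool) →
  (∀ i j → h (combine i j) ≡ f i xor g j) →
  count h ≡ count f * count (λ j → not (g j)) + count (λ i → not (f i)) * count g
count-combine zero h f g eq = refl
count-combine (suc m) {n} h f g eq = begin
  count h
    ≡⟨ count-++ n h ⟩
  count (λ j → h (j ↑ˡ (m * n))) + count (λ k → h (n ↑ʳ k))
    ≡⟨ cong₂ _+_ (count-cong (eq zero))
         (count-combine m (λ k → h (n ↑ʳ k)) (λ i → f (suc i)) g (λ i → eq (suc i))) ⟩
  count (λ j → f zero xor g j) + (a * ḡ + b * count g)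
    ≡⟨ step (f zero) ⟩
  ((if f zero then 1 else 0) + a) * ḡ + ((if not (f zero) then 1 else 0) + b) * count g ∎
  where
  open ≡-Reasoning
  open +-*-Solver
  a = count (λ i → f (suc i))
  b = count (λ i → not (f (suc i)))
  ḡ = count (λ j → not (g j))
  step : ∀ x → count (λ j → x xor g j) + (a * ḡ + b * count g)
    ≡ ((if x then 1 else 0) + a) * ḡ + ((if not x then 1 else 0) + b) * count g
  step true  = solve 4 (λ a b g ḡ → ḡ :+ (a :* ḡ :+ b :* g)
    := (con 1 :+ a) :* ḡ :+ (con 0 :+ b) :* g) refl a b (count g) ḡ
  step false = solve 4 (λ a b g ḡ → g :+ (a :* ḡ :+ b :* g)
    := (con 0 :+ a) :* ḡ :+ (con 1 :+ b) :* g) refl a b (count g) ḡ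

-- As many ones as zeros, phrased without halving `n`, so that the equality can be used for
-- rewriting in the product argument.
Balanced : ∀ {n} → (Fin n → Bool) → Set
Balanced f = count f ≡ count (λ i → not (f i))

balanced-cong : ∀ {n} {f g : Fin n → Bool} → (∀ i → f i ≡ g i) → Balanced f → Balanced g
balanced-cong f≗g bal =
  trans (sym (count-cong f≗g)) (trans bal (count-cong (λ i → cong not (f≗g i))))

balanced⇒half : ∀ {n} (f : Fin n → Bool) → Balanced f → 2 * count f ≡ n
balanced⇒half f bal = trans (cong (count f +_) (trans (ℕ.+-identityʳ _) bal)) (count-complement f)

half⇒balanced : ∀ {n} (f : Fin n → Bool) → 2 * count f ≡ n → Balanced f
half⇒balanced f half = ℕ.+-cancelˡ-≡ (count f) _ _
  (trans (cong (count f +_) (sym (ℕ.+-identityʳ _))) (trans half (sym (count-complement f))))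

-- The second hypothesis is (|f| - |not f|)(|g| - |not g|) = 0 without subtraction; it holds as soon
-- as one of the two factors is balanced.
balanced-combine : ∀ {m n} {h : Fin (m * n) → Bool} {f : Fin m → Bool} {g : Fin n → Bool} →
  (∀ i j → h (combine i j) ≡ f i xor g j) →
  count f * count (λ j → not (g j)) + count (λ i → not (f i)) * count g ≡
  count f * count g + count (λ i → not (f i)) * count (λ j → not (g j)) →
  Balanced h
balanced-combine {m} {n} {h} {f} {g} eq same = trans (count-combine m h f g eq) (trans same (sym
  (trans
    (count-combine m (λ k → not (h k)) f (λ j → not (g j))
      (λ i j → trans (cong not (eq i j)) (𝔹.not-distribʳ-xor (f i) (g j))))
    (cong (λ k → count f * k + count (λ i → not (f i)) * count (λ j → not (g j)))
      (count-cong (λ j → 𝔹.not-involutive (g j)))))))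

-- Sums and row combinations over F₂

⨁-cong : ∀ {n} {f g : Fin n → Bool} → (∀ i → f i ≡ g i) → ⨁ f ≡ ⨁ g
⨁-cong {zero}  f≗g = refl
⨁-cong {suc n} f≗g = cong₂ _xor_ (f≗g zero) (⨁-cong (λ i → f≗g (suc i)))

⨁-zero : ∀ {n} {f : Fin n → Bool} → (∀ i → f i ≡ false) → ⨁ f ≡ false
⨁-zero {zero}  f≗0 = refl
⨁-zero {suc n} f≗0 = cong₂ _xor_ (f≗0 zero) (⨁-zero (λ i → f≗0 (suc i)))

⨁-++ : ∀ m {n} (f : Fin (m + n) → Bool) →
  ⨁ f ≡ ⨁ (λ i → f (i ↑ˡ n)) xor ⨁ (λ j → f (m ↑ʳ j))
⨁-++ zero    f = refl
⨁-++ (suc m) f = trans (cong (f zero xor_) (⨁-++ m (λ i → f (suc i))))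
  (sym (𝔹.xor-assoc (f zero) _ _))

rank-cong : ∀ {m n r} {M N : Matrix₂ m n} → (∀ i j → M i j ≡ N i j) → Rank₂ M r → Rank₂ N r
rank-cong {M = M} {N} M≗N (ρ , independent , span) =
  ρ ,
  (λ c c≗0 → independent c (λ j → trans (combo-cong c j) (c≗0 j))) ,
  (λ i → proj₁ (span i) , λ j → trans (sym (combo-cong _ j)) (trans (proj₂ (span i) j) (M≗N i j)))
  where
  combo-cong : ∀ c j → combo M ρ c j ≡ combo N ρ c j
  combo-cong c j = ⨁-cong (λ t → cong (c t ∧_) (M≗N (ρ t) j))

rank-zero : ∀ {m n} {M : Matrix₂ m n} → (∀ i j → M i j ≡ false) → Rank₂ M 0
rank-zero M≗0 = (λ ()) , (λ _ _ ()) , (λ i → (λ ()) , λ j → sym (M≗0 i j))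

-- Alternating matrices

Alternating : ∀ {n} → Matrix₂ n n → Set
Alternating M = (∀ i j → M i j ≡ M j i) × (∀ i → M i i ≡ false)

alternating-cong : ∀ {n} {M N : Matrix₂ n n} →
  (∀ i j → M i j ≡ N i j) → Alternating M → Alternating N
alternating-cong M≗N (M-sym , M-diag) =
  (λ i j → trans (sym (M≗N i j)) (trans (M-sym i j) (M≗N j i))) ,
  (λ i → trans (sym (M≗N i i)) (M-diag i))

-- Adds the alternating form of rank at most 2 spanned by `u` and `v`. It serves both for
-- eliminating a pivot pair and for switching.
toggle : ∀ {n} → (u v : Fin n → Bool) → Matrix₂ n n → Matrix₂ n n
toggle u v M i j = M i j xor ((u i ∧ v j) xor (v i ∧ u j))

toggle-alternating : ∀ {n} (u v : Fin n → Bool) {M : Matrix₂ n n} →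
  Alternating M → Alternating (toggle u v M)
toggle-alternating u v {M} (M-sym , M-diag) =
  (λ i j → cong₂ _xor_ (M-sym i j)
    (trans (𝔹.xor-comm (u i ∧ v j) (v i ∧ u j))
      (cong₂ _xor_ (𝔹.∧-comm (v i) (u j)) (𝔹.∧-comm (u i) (v j))))) ,
  (λ i → cong₂ _xor_ (M-diag i)
    (trans (cong (_xor (v i ∧ u i)) (𝔹.∧-comm (u i) (v i))) (𝔹.xor-same (v i ∧ u i))))

combo-toggle : ∀ {n r} (u v : Fin n → Bool) (M : Matrix₂ n n) (ρ : Fin r → Fin n) c j →
  combo M ρ c j ≡ combo (toggle u v M) ρ c j
    xor ((⨁ (λ t → c t ∧ u (ρ t)) ∧ v j) xor (⨁ (λ t → c t ∧ v (ρ t)) ∧ u j))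
combo-toggle {r = zero}  u v M ρ c j = refl
combo-toggle {r = suc r} u v M ρ c j = trans
  (cong ((c zero ∧ M (ρ zero) j) xor_)
    (combo-toggle u v M (λ t → ρ (suc t)) (λ t → c (suc t)) j))
  (solve 9 (λ c m k a b x y p q →
      c :* m :+ (k :+ (a :* q :+ b :* p)) :=
      (c :* (m :+ (x :* q :+ y :* p)) :+ k) :+ ((c :* x :+ a) :* q :+ (c :* y :+ b) :* p))
    refl (c zero) (M (ρ zero) j) (combo (toggle u v M) (λ t → ρ (suc t)) (λ t → c (suc t)) j)
    (⨁ (λ t → c (suc t) ∧ u (ρ (suc t)))) (⨁ (λ t → c (suc t) ∧ v (ρ (suc t))))
    (u (ρ zero)) (v (ρ zero)) (u j) (v j))
  where open xor-∧-Solver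

-- Rows p and q of M, together with rows of the toggled matrix M′ (which vanishes in columns p and
-- q), form a basis of the row space of M.
rank-toggle : ∀ {n r} {M : Matrix₂ n n} → Alternating M → ∀ p q → M p q ≡ true →
  Rank₂ (toggle (M p) (M q) M) r → Rank₂ M (2 + r)
rank-toggle {n} {r} {M} (M-sym , M-diag) p q Mpq (ρ , independent , span) =
  ρ⁺ , independent⁺ , span⁺
  where
  M′ : Matrix₂ n n
  M′ = toggle (M p) (M q) M
  ρ⁺ : Fin (2 + r) → Fin n
  ρ⁺ = p F.∷ q F.∷ ρ

  Mqp : M q p ≡ true
  Mqp = trans (M-sym q p) Mpq

  column-p : ∀ i → M′ i p ≡ false
  column-p i = trans
    (cong₂ (λ x y → M i p xor ((M p i ∧ x) xor (M q i ∧ y))) Mqp (M-diag p))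
    (trans (cong (λ x → x xor ((M p i ∧ true) xor (M q i ∧ false))) (M-sym i p))
      (solve 2 (λ x y → x :+ (x :* con true :+ y :* con false) := con false) refl (M p i) (M q i)))
    where open xor-∧-Solver

  column-q : ∀ i → M′ i q ≡ false
  column-q i = trans
    (cong₂ (λ x y → M i q xor ((M p i ∧ x) xor (M q i ∧ y))) (M-diag q) Mpq)
    (trans (cong (λ x → x xor ((M p i ∧ false) xor (M q i ∧ true))) (M-sym i q))
      (solve 2 (λ x y → x :+ (y :* con false :+ x :* con true) := con false) refl (M q i) (M p i)))
    where open xor-∧-Solver

  combo-column : ∀ c j → (∀ i → M′ i j ≡ false) → combo M′ ρ c j ≡ false
  combo-column c j M′j≗0 = ⨁-zero (λ t → trans (cong (c t ∧_) (M′j≗0 (ρ t))) (𝔹.∧-zeroʳ (c t)))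

  -- Trading the rows of `M` for those of `M′` costs only multiples of rows `p` and `q`; the
  -- coefficients shift by the pairings of `c` with `M q` and `M p`.
  expand : ∀ x y c j → (x ∧ M p j) xor ((y ∧ M q j) xor combo M ρ c j) ≡
    ((x xor ⨁ (λ t → c t ∧ M q (ρ t))) ∧ M p j) xor
    (((y xor ⨁ (λ t → c t ∧ M p (ρ t))) ∧ M q j) xor combo M′ ρ c j)
  expand x y c j = trans
    (cong (λ z → (x ∧ M p j) xor ((y ∧ M q j) xor z)) (combo-toggle (M p) (M q) M ρ c j))
    (solve 7 (λ x y k a b p q →
      x :* p :+ (y :* q :+ (k :+ (a :* q :+ b :* p))) :=
      (x :+ b) :* p :+ ((y :+ a) :* q :+ k)) refl
      x y (combo M′ ρ c j) (⨁ (λ t → c t ∧ M p (ρ t))) (⨁ (λ t → c t ∧ M q (ρ t))) (M p j) (M q j))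
    where open xor-∧-Solver

  first : ∀ x y {a b k} → a ≡ true → b ≡ false → k ≡ false →
    (x ∧ a) xor ((y ∧ b) xor k) ≡ x
  first x y refl refl refl =
    solve 2 (λ x y → x :* con true :+ (y :* con false :+ con false) := x) refl x y
    where open xor-∧-Solver

  second : ∀ x y {a b k} → a ≡ false → b ≡ true → k ≡ false →
    (x ∧ a) xor ((y ∧ b) xor k) ≡ y
  second x y refl refl refl =
    solve 2 (λ x y → x :* con false :+ (y :* con true :+ con false) := y) refl x y
    where open xor-∧-Solver

  independent⁺ : RowsIndependent M ρ⁺
  independent⁺ c c≗0 = λ where
      zero          → trans (sym (head-zero (c zero) (M q))) x≡0
      (suc zero)    → trans (sym (head-zero (c (suc zero)) (M p))) y≡0
      (suc (suc t)) → c′≗0 t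
    where
    c′ : Fin r → Bool
    c′ t = c (suc (suc t))
    x y : Bool
    x = c zero xor ⨁ (λ t → c′ t ∧ M q (ρ t))
    y = c (suc zero) xor ⨁ (λ t → c′ t ∧ M p (ρ t))
    sum≗0 : ∀ j → (x ∧ M p j) xor ((y ∧ M q j) xor combo M′ ρ c′ j) ≡ false
    sum≗0 j = trans (sym (expand (c zero) (c (suc zero)) c′ j)) (c≗0 j)
    -- In column `q`, row `p` has entry 1 while row `q` and all of `M′` vanish, so only `x`
    -- survives; column `p` isolates `y` in the same way.
    x≡0 : x ≡ false
    x≡0 = trans (sym (first x y Mpq (M-diag q) (combo-column c′ q column-q))) (sum≗0 q)
    y≡0 : y ≡ false
    y≡0 = trans (sym (second x y (M-diag p) Mqp (combo-column c′ p column-p))) (sum≗0 p)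
    c′≗0 : ∀ t → c′ t ≡ false
    c′≗0 = independent c′ (λ j → trans
      (sym (cong₂ (λ x y → (x ∧ M p j) xor ((y ∧ M q j) xor combo M′ ρ c′ j)) x≡0 y≡0)) (sum≗0 j))
    -- With `c′` zero the shifts in `x` and `y` disappear, so the original first two coefficients
    -- vanish as well.
    head-zero : ∀ b (w : Fin n → Bool) → b xor ⨁ (λ t → c′ t ∧ w (ρ t)) ≡ b
    head-zero b w = trans (cong (b xor_) (⨁-zero (λ t → cong (_∧ w (ρ t)) (c′≗0 t))))
      (𝔹.xor-identityʳ b)

  span⁺ : RowsSpan M ρ⁺
  span⁺ i = (x F.∷ y F.∷ c) , λ j → trans (expand x y c j) (trans
      (cong (λ k → ((x xor b) ∧ M p j) xor (((y xor a) ∧ M q j) xor k)) (proj₂ (span i) j))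
      (solve 7 (λ m pi qi a b pj qj →
          ((qi :+ b) :+ b) :* pj :+ (((pi :+ a) :+ a) :* qj :+ (m :+ (pi :* qj :+ qi :* pj))) := m)
        refl (M i j) (M p i) (M q i) a b (M p j) (M q j)))
    where
    open xor-∧-Solver
    c = proj₁ (span i)
    a = ⨁ (λ t → c t ∧ M p (ρ t))
    b = ⨁ (λ t → c t ∧ M q (ρ t))
    -- Row `i` of `M` is row `i` of `M′` plus `M q i` times row `p` plus `M p i` times row `q`;
    -- adding `b` and `a` cancels the shifts made by `expand`.
    x = M q i xor b
    y = M p i xor a

-- Hadamard matrices in additive notation

Orthogonal : ∀ {n} → Matrix₂ n n → Set
Orthogonal M = ∀ i j → i ≢ j → Balanced (λ k → M i k xor M j k)

-- The zero row at `origin` serves twice: it makes ranks add under products, and it is the vertex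
-- deleted at the end.
record Graphical (n r : ℕ) : Set where
  field
    matrix      : Matrix₂ n n
    alternating : Alternating matrix
    origin      : Fin n
    isolated    : ∀ j → matrix origin j ≡ false
    orthogonal  : Orthogonal matrix
    rank        : Rank₂ matrix r

-- Kronecker products

_⊞_ : ∀ {m n} → Matrix₂ m m → Matrix₂ n n → Matrix₂ (m * n) (m * n)
_⊞_ {m} {n} M N x y =
  M (quotient {m} n x) (quotient {m} n y) xor N (remainder {m} n x) (remainder {m} n y)

⊞-alternating : ∀ {m n} {M : Matrix₂ m m} {N : Matrix₂ n n} →
  Alternating M → Alternating N → Alternating (M ⊞ N)
⊞-alternating (M-sym , M-diag) (N-sym , N-diag) =
  (λ x y → cong₂ _xor_ (M-sym _ _) (N-sym _ _)) , (λ x → cong₂ _xor_ (M-diag _) (N-diag _))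

⊞-column : ∀ {m n} (M : Matrix₂ m m) (N : Matrix₂ n n) x k l →
  (M ⊞ N) x (combine k l) ≡ M (quotient {m} n x) k xor N (remainder {m} n x) l
⊞-column {m} {n} M N x k l =
  cong (λ y → M (quotient {m} n x) (proj₁ y) xor N (remainder {m} n x) (proj₂ y))
    (remQuot-combine {m} {n} k l)

⊞-combine : ∀ {m n} (M : Matrix₂ m m) (N : Matrix₂ n n) i j k l →
  (M ⊞ N) (combine i j) (combine k l) ≡ M i k xor N j l
⊞-combine {m} {n} M N i j k l = trans (⊞-column M N (combine i j) k l)
  (cong (λ x → M (proj₁ x) k xor N (proj₂ x) l) (remQuot-combine {m} {n} i j))

-- Distinct indices differ in their quotient or their remainder, and orthogonality of that factor
-- makes the corresponding difference balanced.
⊞-orthogonal : ∀ {m n} {M : Matrix₂ m m} {N : Matrix₂ n n} →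
  Orthogonal M → Orthogonal N → Orthogonal (M ⊞ N)
⊞-orthogonal {m} {n} {M} {N} M-orth N-orth x y x≢y =
  balanced-combine {m} {n} {f = f} {g} separate same
  where
  f : Fin m → Bool
  f k = M (quotient {m} n x) k xor M (quotient {m} n y) k
  g : Fin n → Bool
  g l = N (remainder {m} n x) l xor N (remainder {m} n y) l
  separate : ∀ k l → (M ⊞ N) x (combine k l) xor (M ⊞ N) y (combine k l) ≡ f k xor g l
  separate k l = trans (cong₂ _xor_ (⊞-column M N x k l) (⊞-column M N y k l))
    (solve 4 (λ a b c d → (a :+ b) :+ (c :+ d) := (a :+ c) :+ (b :+ d)) refl
      (M (quotient {m} n x) k) (N (remainder {m} n x) l) (M (quotient {m} n y) k) (N (remainder {m} n y) l))
    where open xor-∧-Solver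
  same : count f * count (λ j → not (g j)) + count (λ i → not (f i)) * count g ≡
    count f * count g + count (λ i → not (f i)) * count (λ j → not (g j))
  same with quotient n x ≟ quotient n y
  ... | no  qx≢qy rewrite M-orth _ _ qx≢qy = ℕ.+-comm (count (λ i → not (f i)) * _) _
  ... | yes qx≡qy rewrite N-orth _ _ (λ rx≡ry → x≢y (trans (sym (combine-remQuot {m} n x))
      (trans (cong₂ combine qx≡qy rx≡ry) (combine-remQuot {m} n y)))) = refl

-- A basis is formed by the chosen rows of `M` paired with `o′` and those of `N` paired with `o`. By
-- symmetry columns `o` and `o′` vanish too, so restricting a relation to column `o′` of `N` or `o`
-- of `M` separates the two factors.
⊞-rank : ∀ {m n r s} {M : Matrix₂ m m} {N : Matrix₂ n n} {o : Fin m} {o′ : Fin n} →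
  Alternating M → Alternating N → (∀ k → M o k ≡ false) → (∀ l → N o′ l ≡ false) →
  Rank₂ M r → Rank₂ N s → Rank₂ (M ⊞ N) (r + s)
⊞-rank {m} {n} {r} {s} {M} {N} {o} {o′} (M-sym , _) (N-sym , _) Mo≗0 No′≗0
  (ρ , M-independent , M-span) (σ , N-independent , N-span) = τ , independent , span
  where
  τ : Fin (r + s) → Fin (m * n)
  τ = (λ t → combine (ρ t) o′) F.++ (λ t → combine o (σ t))

  combo-⊞ : ∀ c k l → combo (M ⊞ N) τ c (combine k l) ≡
    combo M ρ (λ t → c (t ↑ˡ s)) k xor combo N σ (λ t → c (r ↑ʳ t)) l
  combo-⊞ c k l = trans (⨁-++ r _) (cong₂ _xor_
    (⨁-cong (λ t → cong (c (t ↑ˡ s) ∧_) (trans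
      (cong (λ x → (M ⊞ N) x (combine k l)) (lookup-++ˡ (λ t → combine (ρ t) o′) _ t))
      (trans (⊞-combine M N (ρ t) o′ k l)
        (trans (cong (M (ρ t) k xor_) (No′≗0 l)) (𝔹.xor-identityʳ _))))))
    (⨁-cong (λ t → cong (c (r ↑ʳ t) ∧_) (trans
      (cong (λ x → (M ⊞ N) x (combine k l)) (lookup-++ʳ (λ t → combine (ρ t) o′) _ t))
      (trans (⊞-combine M N o (σ t) k l) (cong (_xor N (σ t) l) (Mo≗0 k)))))))

  combo-o : ∀ c → combo M ρ c o ≡ false
  combo-o c = ⨁-zero (λ t →
    trans (cong (c t ∧_) (trans (M-sym (ρ t) o) (Mo≗0 (ρ t)))) (𝔹.∧-zeroʳ (c t)))

  combo-o′ : ∀ c → combo N σ c o′ ≡ false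
  combo-o′ c = ⨁-zero (λ t →
    trans (cong (c t ∧_) (trans (N-sym (σ t) o′) (No′≗0 (σ t)))) (𝔹.∧-zeroʳ (c t)))

  independent : RowsIndependent (M ⊞ N) τ
  independent c c≗0 t with splitAt r t | join-splitAt r s t
  ... | inj₁ a | refl = M-independent (λ t → c (t ↑ˡ s)) (λ k → begin
      combo M ρ (λ t → c (t ↑ˡ s)) k
        ≡⟨ 𝔹.xor-identityʳ _ ⟨
      combo M ρ (λ t → c (t ↑ˡ s)) k xor false
        ≡⟨ cong (combo M ρ (λ t → c (t ↑ˡ s)) k xor_) (combo-o′ (λ t → c (r ↑ʳ t))) ⟨
      combo M ρ (λ t → c (t ↑ˡ s)) k xor combo N σ (λ t → c (r ↑ʳ t)) o′
        ≡⟨ combo-⊞ c k o′ ⟨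
      combo (M ⊞ N) τ c (combine k o′)
        ≡⟨ c≗0 (combine k o′) ⟩
      false ∎) a
    where open ≡-Reasoning
  ... | inj₂ b | refl = N-independent (λ t → c (r ↑ʳ t)) (λ l → begin
      combo N σ (λ t → c (r ↑ʳ t)) l
        ≡⟨ cong (_xor combo N σ (λ t → c (r ↑ʳ t)) l) (combo-o (λ t → c (t ↑ˡ s))) ⟨
      combo M ρ (λ t → c (t ↑ˡ s)) o xor combo N σ (λ t → c (r ↑ʳ t)) l
        ≡⟨ combo-⊞ c o l ⟨
      combo (M ⊞ N) τ c (combine o l)
        ≡⟨ c≗0 (combine o l) ⟩
      false ∎) b
    where open ≡-Reasoning

  span : RowsSpan (M ⊞ N) τ
  span x = (a F.++ b) , λ y → begin
      combo (M ⊞ N) τ (a F.++ b) y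
        ≡⟨ cong (combo (M ⊞ N) τ (a F.++ b)) (combine-remQuot {m} n y) ⟨
      combo (M ⊞ N) τ (a F.++ b) (combine (quotient {m} n y) (remainder {m} n y))
        ≡⟨ combo-⊞ (a F.++ b) (quotient {m} n y) (remainder {m} n y) ⟩
      combo M ρ (λ t → (a F.++ b) (t ↑ˡ s)) (quotient {m} n y) xor
      combo N σ (λ t → (a F.++ b) (r ↑ʳ t)) (remainder {m} n y)
        ≡⟨ cong₂ _xor_
             (⨁-cong (λ t → cong (_∧ M (ρ t) (quotient {m} n y)) (lookup-++ˡ a b t)))
             (⨁-cong (λ t → cong (_∧ N (σ t) (remainder {m} n y)) (lookup-++ʳ a b t))) ⟩
      combo M ρ a (quotient {m} n y) xor combo N σ b (remainder {m} n y)
        ≡⟨ cong₂ _xor_ (proj₂ (M-span (quotient {m} n x)) _) (proj₂ (N-span (remainder {m} n x)) _) ⟩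
      (M ⊞ N) x y ∎
    where
    open ≡-Reasoning
    a : Fin r → Bool
    a = proj₁ (M-span (quotient {m} n x))
    b : Fin s → Bool
    b = proj₁ (N-span (remainder {m} n x))

_⊠_ : ∀ {m n r s} → Graphical m r → Graphical n s → Graphical (m * n) (r + s)
G ⊠ H = record
  { matrix      = G.matrix ⊞ H.matrix
  ; alternating = ⊞-alternating {M = G.matrix} {H.matrix} G.alternating H.alternating
  ; origin      = combine G.origin H.origin
  ; isolated    = λ y → trans
      (cong (λ x → G.matrix (proj₁ x) _ xor H.matrix (proj₂ x) _) (remQuot-combine G.origin H.origin))
      (cong₂ _xor_ (G.isolated _) (H.isolated _))
  ; orthogonal  = ⊞-orthogonal {M = G.matrix} {H.matrix} G.orthogonal H.orthogonal
  ; rank        = ⊞-rank {M = G.matrix} {H.matrix} G.alternating H.alternating G.isolated H.isolated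
      G.rank H.rank
  }
  where
  module G = Graphical G
  module H = Graphical H

point : Graphical 1 0
point = record
  { matrix      = λ _ _ → false
  ; alternating = (λ _ _ → refl) , (λ _ → refl)
  ; origin      = zero
  ; isolated    = λ _ → refl
  ; orthogonal  = λ { zero zero 0≢0 → ⊥-elim (0≢0 refl) }
  ; rank        = rank-zero (λ _ _ → refl)
  }

-- Deleting the isolated vertex

module _ {m r} (G : Graphical (suc m) r) where
  open Graphical G

  private
    vertex : Fin m → Fin (suc m)
    vertex = punchIn origin

    column-origin : ∀ i → matrix i origin ≡ false
    column-origin i = trans (proj₁ alternating i origin) (isolated i)

  graph : Graph m
  graph = record
    { adj       = λ i j → matrix (vertex i) (vertex j)
    ; symmetric = λ i j → proj₁ alternating (vertex i) (vertex j)
    ; loopless  = λ i → proj₂ alternating (vertex i)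
    }

  private
    -- The degree is the distance of the row from the zero row of `origin`; the deleted column
    -- contributes nothing.
    degree-half : ∀ i → 2 * degree graph i ≡ suc m
    degree-half i = trans (cong (2 *_) (count-punchIn origin (matrix (vertex i)) (column-origin (vertex i))))
      (balanced⇒half (matrix (vertex i)) (balanced-cong
        (λ k → trans (cong (matrix (vertex i) k xor_) (isolated k))
          (𝔹.xor-identityʳ (matrix (vertex i) k)))
        (orthogonal (vertex i) origin (punchInᵢ≢i origin i))))

    difference-half : ∀ i j → i ≢ j → 2 * count (λ k → adj graph i k xor adj graph j k) ≡ suc m
    difference-half i j i≢j = trans
      (cong (2 *_) (count-punchIn origin difference
        (cong₂ _xor_ (column-origin (vertex i)) (column-origin (vertex j)))))
      (balanced⇒half difference
        (orthogonal (vertex i) (vertex j) (λ eq → i≢j (punchIn-injective origin i j eq))))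
      where
      difference : Fin (suc m) → Bool
      difference k = matrix (vertex i) k xor matrix (vertex j) k

  graph-srg : ∀ k l → 2 * k ≡ suc m → 2 * l ≡ k → IsSRG m k l l graph
  graph-srg k l 2k 2l =
    (λ i → halve (degree graph i) (degree-half i)) ,
    (λ i j ij → common i j (λ { refl → true≢false (trans (sym ij) (loopless graph i)) })) ,
    (λ i j i≢j _ → common i j i≢j)
    where
    true≢false : true ≢ false
    true≢false ()
    halve : ∀ a → 2 * a ≡ suc m → a ≡ k
    halve a 2a = ℕ.*-cancelˡ-≡ a k 2 (trans 2a (sym 2k))
    common : ∀ i j → i ≢ j → commonNeighbours graph i j ≡ l
    -- The rows differ in `k` places and both degrees are `k`, so `k + 2 * common = k + 2 * l`.
    -- Adjacency of `i` and `j` does not enter, whence λ = μ.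
    common i j i≢j = ℕ.*-cancelˡ-≡ (commonNeighbours graph i j) l 2 (ℕ.+-cancelˡ-≡ k _ _ (begin
      k + 2 * commonNeighbours graph i j
        ≡⟨ cong (_+ 2 * commonNeighbours graph i j) (halve (count difference) (difference-half i j i≢j)) ⟨
      count difference + 2 * commonNeighbours graph i j
        ≡⟨ count-xor (adj graph i) (adj graph j) ⟩
      degree graph i + degree graph j
        ≡⟨ cong₂ _+_ (halve (degree graph i) (degree-half i))
             (trans (halve (degree graph j) (degree-half j)) (sym 2l)) ⟩
      k + 2 * l ∎))
      where
      open ≡-Reasoning
      difference : Fin m → Bool
      difference x = adj graph i x xor adj graph j x

  -- A basis cannot contain the zero row of `origin`, so its rows survive the deletion; the deleted
  -- column is zero, so relations among rows are unchanged.
  graph-rank : TwoRank graph r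
  graph-rank = ρ′ , independent′ , span′
    where
    ρ = proj₁ rank
    independent = proj₁ (proj₂ rank)
    span = proj₂ (proj₂ rank)

    ρ≢origin : ∀ t → origin ≢ ρ t
    ρ≢origin t o≡ρt = absurd (trans (sym (dec-true (t ≟ t) refl)) (independent δ δ≗0 t))
      where
      absurd : true ≢ false
      absurd ()
      δ : Fin r → Bool
      δ s = does (s ≟ t)
      δ≗0 : ∀ j → combo matrix ρ δ j ≡ false
      δ≗0 j = ⨁-zero term
        where
        term : ∀ s → δ s ∧ matrix (ρ s) j ≡ false
        term s with s ≟ t
        ... | no  _    = refl
        ... | yes refl = trans (cong (λ i → matrix i j) (sym o≡ρt)) (isolated j)

    ρ′ : Fin r → Fin m
    ρ′ t = punchOut (ρ≢origin t)

    combo′ : ∀ c j → combo (adj graph) ρ′ c j ≡ combo matrix ρ c (vertex j)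
    combo′ c j = ⨁-cong (λ t →
      cong (λ i → c t ∧ matrix i (vertex j)) (punchIn-punchOut (ρ≢origin t)))

    independent′ : RowsIndependent (adj graph) ρ′
    independent′ c c≗0 = independent c all-zero
      where
      all-zero : ∀ j → combo matrix ρ c j ≡ false
      all-zero j with origin ≟ j
      ... | yes refl = ⨁-zero (λ t → trans (cong (c t ∧_) (column-origin (ρ t))) (𝔹.∧-zeroʳ (c t)))
      ... | no  o≢j  = trans (cong (combo matrix ρ c) (sym (punchIn-punchOut o≢j)))
        (trans (sym (combo′ c (punchOut o≢j))) (c≗0 _))

    span′ : RowsSpan (adj graph) ρ′
    span′ i = proj₁ (span (vertex i)) ,
      λ j → trans (combo′ _ j) (proj₂ (span (vertex i)) (vertex j))

-- Certified tables

-- Entries of a Matrix₂ would be recomputed at each use when the certificates below are evaluated.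
Table : ℕ → Set
Table n = Vec (Vec Bool n) n

⟦_⟧ : ∀ {n} → Table n → Matrix₂ n n
⟦ T ⟧ i j = lookup (lookup T i) j

table : ∀ {n} → Matrix₂ n n → Table n
table M = tabulate (λ i → tabulate (M i))

⟦table⟧ : ∀ {n} (M : Matrix₂ n n) i j → M i j ≡ ⟦ table M ⟧ i j
⟦table⟧ M i j = sym (trans
  (cong (λ row → lookup row j) (lookup∘tabulate (λ i → tabulate (M i)) i))
  (lookup∘tabulate (M i) j))

-- The bit is inspected once per row, and a row with coefficient 0 is passed on untouched during
-- evaluation.
addIf : ∀ {n} → Bool → Vec Bool n → Vec Bool n → Vec Bool n
addIf false u w = w
addIf true  u w = zipWith _xor_ u w

lookup-addIf : ∀ {n} b (u w : Vec Bool n) j → lookup (addIf b u w) j ≡ (b ∧ lookup u j) xor lookup w j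
lookup-addIf false u w j = refl
lookup-addIf true  u w j = lookup-zipWith _xor_ j u w

toggleTable : ∀ {n} → Vec Bool n → Vec Bool n → Table n → Table n
toggleTable u v T = zipWith (λ ab w → addIf (proj₁ ab) v (addIf (proj₂ ab) u w)) (zip u v) T

⟦toggleTable⟧ : ∀ {n} (u v : Vec Bool n) (T : Table n) i j →
  toggle (lookup u) (lookup v) ⟦ T ⟧ i j ≡ ⟦ toggleTable u v T ⟧ i j
⟦toggleTable⟧ u v T i j = sym (begin
  lookup (lookup (toggleTable u v T) i) j
    ≡⟨ cong (λ row → lookup row j) (lookup-zipWith _ i (zip u v) T) ⟩
  lookup (addIf (proj₁ (lookup (zip u v) i)) v (addIf (proj₂ (lookup (zip u v) i)) u (lookup T i))) j
    ≡⟨ cong (λ ab → lookup (addIf (proj₁ ab) v (addIf (proj₂ ab) u (lookup T i))) j) (lookup-zip i u v) ⟩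
  lookup (addIf a v (addIf b u (lookup T i))) j
    ≡⟨ lookup-addIf a v (addIf b u (lookup T i)) j ⟩
  (a ∧ lookup v j) xor lookup (addIf b u (lookup T i)) j
    ≡⟨ cong ((a ∧ lookup v j) xor_) (lookup-addIf b u (lookup T i) j) ⟩
  (a ∧ lookup v j) xor ((b ∧ lookup u j) xor ⟦ T ⟧ i j)
    ≡⟨ solve 3 (λ x y z → x :+ (y :+ z) := z :+ (x :+ y)) refl
         (a ∧ lookup v j) (b ∧ lookup u j) (⟦ T ⟧ i j) ⟩
  toggle (lookup u) (lookup v) ⟦ T ⟧ i j ∎)
  where
  open ≡-Reasoning
  open xor-∧-Solver using (solve; _:+_; _:=_)
  a b : Bool
  a = lookup u i
  b = lookup v i

toggleTable-alternating : ∀ {n} (u v : Vec Bool n) {T : Table n} →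
  Alternating ⟦ T ⟧ → Alternating ⟦ toggleTable u v T ⟧
toggleTable-alternating u v {T} alt =
  alternating-cong (⟦toggleTable⟧ u v T) (toggle-alternating (lookup u) (lookup v) alt)

distance : ∀ {n} → Vec Bool n → Vec Bool n → ℕ
distance []          []          = 0
distance (false ∷ u) (false ∷ v) = distance u v
distance (false ∷ u) (true  ∷ v) = suc (distance u v)
distance (true  ∷ u) (false ∷ v) = suc (distance u v)
distance (true  ∷ u) (true  ∷ v) = distance u v

count-distance : ∀ {n} (u v : Vec Bool n) → count (λ k → lookup u k xor lookup v k) ≡ distance u v
count-distance []          []          = refl
count-distance (false ∷ u) (false ∷ v) = count-distance u v
count-distance (false ∷ u) (true  ∷ v) = cong suc (count-distance u v)
count-distance (true  ∷ u) (false ∷ v) = cong suc (count-distance u v)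
count-distance (true  ∷ u) (true  ∷ v) = count-distance u v

distance-comm : ∀ {n} (u v : Vec Bool n) → distance u v ≡ distance v u
distance-comm u v = trans (sym (count-distance u v))
  (trans (count-cong (λ k → 𝔹.xor-comm (lookup u k) (lookup v k))) (count-distance v u))

allPairs-lookup : ∀ {A : Set} {R : A → A → Set} → Symmetric R → ∀ {n} {xs : Vec A n} →
  AllPairs R xs → ∀ i j → i ≢ j → R (lookup xs i) (lookup xs j)
allPairs-lookup R-sym (rx ∷ rxs) zero    zero    i≢j = ⊥-elim (i≢j refl)
allPairs-lookup R-sym (rx ∷ rxs) zero    (suc j) i≢j = Allₚ.lookup⁺ rx j
allPairs-lookup R-sym (rx ∷ rxs) (suc i) zero    i≢j = R-sym (Allₚ.lookup⁺ rx i)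
allPairs-lookup R-sym (rx ∷ rxs) (suc i) (suc j) i≢j =
  allPairs-lookup R-sym rxs i j (λ i≡j → i≢j (cong suc i≡j))

-- Symplectic Gaussian elimination: each pivot pair splits off a hyperbolic plane, and nothing may
-- remain at the end. The rank is therefore twice the number of pairs.
Eliminates : ∀ {n} → List (Fin n × Fin n) → Table n → Set
Eliminates []             T = All (All (_≡ false)) T
Eliminates ((p , q) ∷ ps) T =
  ⟦ T ⟧ p q ≡ true × Eliminates ps (toggleTable (lookup T p) (lookup T q) T)

eliminates? : ∀ {n} (ps : List (Fin n × Fin n)) T → Dec (Eliminates ps T)
eliminates? []             T = All.all? (All.all? (𝔹._≟ false)) T
eliminates? ((p , q) ∷ ps) T =
  (⟦ T ⟧ p q 𝔹.≟ true) ×-dec eliminates? ps (toggleTable (lookup T p) (lookup T q) T)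

eliminates⇒rank : ∀ {n} ps (T : Table n) → Alternating ⟦ T ⟧ → Eliminates ps T →
  Rank₂ ⟦ T ⟧ (length ps * 2)
eliminates⇒rank []             T alt T≗0         =
  rank-zero (λ i j → Allₚ.lookup⁺ (Allₚ.lookup⁺ T≗0 i) j)
eliminates⇒rank ((p , q) ∷ ps) T alt (Tpq , elim) =
  rank-toggle alt p q Tpq (rank-cong (λ i j → sym (⟦toggleTable⟧ u v T i j))
    (eliminates⇒rank ps (toggleTable u v T) (toggleTable-alternating u v {T} alt) elim))
  where
  u = lookup T p
  v = lookup T q

Certificate : ∀ {n} → Fin n → List (Fin n × Fin n) → Table n → Set
Certificate {n} o ps T =
  AllPairs (λ u v → 2 * distance u v ≡ n) T × All (_≡ false) (lookup T o) × Eliminates ps T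

certificate? : ∀ {n} o ps (T : Table n) → Dec (Certificate o ps T)
certificate? {n} o ps T =
  allPairs? (λ u v → 2 * distance u v ℕ.≟ n) T ×-dec
  (All.all? (𝔹._≟ false) (lookup T o) ×-dec eliminates? ps T)

certified : ∀ {n} o ps (T : Table n) → Alternating ⟦ T ⟧ → Certificate o ps T →
  Graphical n (length ps * 2)
certified {n} o ps T alt (pairs , isolated , elim) = record
  { matrix      = ⟦ T ⟧
  ; alternating = alt
  ; origin      = o
  ; isolated    = Allₚ.lookup⁺ isolated
  ; orthogonal  = λ i j i≢j → half⇒balanced (λ k → ⟦ T ⟧ i k xor ⟦ T ⟧ j k) (trans
      (cong (2 *_) (count-distance (lookup T i) (lookup T j)))
      -- The certificate compares each unordered pair of rows once; symmetry of the distance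
      -- supplies the other order.
      (allPairs-lookup {R = λ u v → 2 * distance u v ≡ n}
        (λ {u} {v} eq → trans (cong (2 *_) (distance-comm v u)) eq) pairs i j i≢j))
  ; rank        = eliminates⇒rank ps T alt elim
  }

-- The matrices of orders 4 and 64

-- Vertex `zero` is the adjoined isolated vertex.
K₃ : Matrix₂ 4 4
K₃ (suc i) (suc j) = not (does (i ≟ j))
K₃ _       _       = false

K₃-alternating : Alternating K₃
K₃-alternating = toWitness
  {a? = all? (λ i → all? λ j → K₃ i j 𝔹.≟ K₃ j i) ×-dec all? (λ i → K₃ i i 𝔹.≟ false)} _

triangle : Graphical 4 2
triangle = certified zero ps (table K₃) (alternating-cong (⟦table⟧ K₃) K₃-alternating)
  (toWitness {a? = certificate? zero ps (table K₃)} _)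
  where
  ps : List (Fin 4 × Fin 4)
  ps = (# 1 , # 2) ∷ []

-- Switching the matrix of order 64

indicator : ∀ {n} → List (Fin n) → Vec Bool n
indicator C = tabulate (λ x → any (λ y → does (x ≟ y)) C)

-- This set is disjoint from `C`, so toggling by the two indicators flips exactly the entries
-- between it and `C`. As an update of rank at most 2, this changes the 2-rank by at most 2.
mixed : ∀ {n} → Table n → List (Fin n) → Vec Bool n
mixed T C = tabulate (λ x → not (lookup (indicator C) x) ∧
  (any (λ y → ⟦ T ⟧ y x) C ∧ not (all (λ y → ⟦ T ⟧ y x) C)))

-- Godsil–McKay switching: for the sets used below, a vertex outside C that has some but not all of
-- C as neighbours has exactly half of them, and these are exchanged for the other half.
switch : ∀ {n} → Table n → List (Fin n) → Table n
switch T C = toggleTable (indicator C) (mixed T C) T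

-- The switching sets and the pivots were found by computer search.
switchingSets : List (List (Fin 64))
switchingSets =
  (# 1 ∷ # 2 ∷ # 5  ∷ # 6  ∷ []) ∷
  (# 1 ∷ # 2 ∷ # 9  ∷ # 10 ∷ []) ∷
  (# 1 ∷ # 2 ∷ # 17 ∷ # 18 ∷ []) ∷
  (# 1 ∷ # 2 ∷ # 33 ∷ # 34 ∷ []) ∷
  (# 3 ∷ # 4 ∷ # 16 ∷ # 23 ∷ []) ∷
  (# 3 ∷ # 4 ∷ # 32 ∷ # 39 ∷ []) ∷ []

pivots : List (Fin 64 × Fin 64)
pivots =
  (# 1 , # 2) ∷ (# 7 , # 8) ∷ (# 24 , # 32) ∷ (# 9 , # 17) ∷ (# 5 , # 21) ∷ (# 13 , # 33) ∷
  (# 25 , # 53) ∷ (# 3 , # 40) ∷ (# 16 , # 19) ∷ []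

switched : ℕ → Table 64
switched s = foldl switch (table (K₃ ⊞ (K₃ ⊞ K₃))) (take s switchingSets)

switched-alternating : ∀ s → Alternating ⟦ switched s ⟧
switched-alternating s = preserved (take s switchingSets) _
  (alternating-cong (⟦table⟧ (K₃ ⊞ (K₃ ⊞ K₃)))
    (⊞-alternating {M = K₃} K₃-alternating
      (⊞-alternating {M = K₃} {K₃} K₃-alternating K₃-alternating)))
  where
  preserved : ∀ {n} Cs (T : Table n) → Alternating ⟦ T ⟧ → Alternating ⟦ foldl switch T Cs ⟧
  preserved []       T alt = alt
  preserved (C ∷ Cs) T alt = preserved Cs (switch T C) 
    (toggleTable-alternating (indicator C) (mixed T C) {T} alt)

abstract
  -- Each switching raises the 2-rank by exactly 2, starting from 6, hence 3 + `s` pivot pairs;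
  -- prefixes of a single pivot list serve all seven matrices. Being abstract, the check is not
  -- unfolded by later uses.
  switched-certificate : ∀ (s : Fin 7) →
    Certificate zero (take (3 + toℕ s) pivots) (switched (toℕ s))
  switched-certificate =
    toWitness {a? = all? λ s → certificate? zero (take (3 + toℕ s) pivots) (switched (toℕ s))} _

block : ∀ s → s ≤ 6 → Graphical 64 (6 + 2 * s)
block s s≤6 = subst (Graphical 64) size
  (certified zero ps (switched s) (switched-alternating s)
    (subst (λ i → Certificate zero (take (3 + i) pivots) (switched i))
      (toℕ-fromℕ< (s≤s s≤6)) (switched-certificate (fromℕ< (s≤s s≤6)))))
  where
  open ≡-Reasoning
  ps : List (Fin 64 × Fin 64)
  ps = take (3 + s) pivots
  size : length ps * 2 ≡ 6 + 2 * s
  size = begin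
    length ps * 2      ≡⟨ cong (_* 2) (length-take (3 + s) pivots) ⟩
    -- There are 9 pivot pairs in all, enough for `s` up to 6.
    ((3 + s) ⊓ 9) * 2  ≡⟨ cong (_* 2) (ℕ.m≤n⇒m⊓n≡m (ℕ.+-monoʳ-≤ 3 s≤6)) ⟩
    6 + s * 2          ≡⟨ cong (6 +_) (ℕ.*-comm s 2) ⟩
    6 + 2 * s          ∎

-- All orders and ranks

family : ∀ ν s → s ≤ 6 * (ν / 3) → Graphical (4 ^ ν) (2 * ν + 2 * s)
-- Below 3 the quotient `ν / 3` is 0, which forces `s` to be 0. Ending each product in `point` makes
-- the order literally `4 ^ ν`.
family 0 .0 z≤n = point
family 1 .0 z≤n = triangle ⊠ point
family 2 .0 z≤n = triangle ⊠ (triangle ⊠ point)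
-- Greedy distribution: one block of order 64 absorbs up to 6 of the `s` rank increments of 2, and
-- the remaining factor takes the rest. The bound allows this because `(3 + ν) / 3` is `1 + ν / 3`.
family (suc (suc (suc ν))) s s≤ =
  subst₂ Graphical order size (block (6 ⊓ s) (ℕ.m⊓n≤m 6 s) ⊠ family ν (s ∸ 6) rest)
  where
  open ≡-Reasoning
  rest : s ∸ 6 ≤ 6 * (ν / 3)
  rest = ℕ.m≤n+o⇒m∸n≤o s 6 (subst (s ≤_)
    (trans (cong (6 *_) (+-distrib-/-∣ˡ {3} ν ∣-refl)) (ℕ.*-distribˡ-+ 6 1 (ν / 3))) s≤)
  order : 64 * 4 ^ ν ≡ 4 ^ (3 + ν)
  order = trans (ℕ.*-assoc 4 16 (4 ^ ν)) (cong (4 *_) (ℕ.*-assoc 4 4 (4 ^ ν)))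
  size : (6 + 2 * (6 ⊓ s)) + (2 * ν + 2 * (s ∸ 6)) ≡ 2 * (3 + ν) + 2 * s
  size = begin
    (6 + 2 * (6 ⊓ s)) + (2 * ν + 2 * (s ∸ 6))
      ≡⟨ solve 3 (λ a ν b → (con 6 :+ con 2 :* a) :+ (con 2 :* ν :+ con 2 :* b) :=
           con 2 :* (con 3 :+ ν) :+ con 2 :* (a :+ b)) refl (6 ⊓ s) ν (s ∸ 6) ⟩
    2 * (3 + ν) + 2 * (6 ⊓ s + (s ∸ 6))
      ≡⟨ cong (λ t → 2 * (3 + ν) + 2 * t) (ℕ.m⊓n+n∸m≡n 6 s) ⟩
    2 * (3 + ν) + 2 * s ∎
    where open +-*-Solver

theorem4p2 : (ν : ℕ) → 1 ≤ ν → (r : ℕ) → 2 ∣ r → 2 * ν ≤ r → r ≤ 2 * ν + 12 * (ν / 3) →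
    Σ (Graph (2 ^ (2 * ν) ∸ 1)) (λ G →
    IsSRG (2 ^ (2 * ν) ∸ 1) (2 ^ (2 * ν ∸ 1)) (2 ^ (2 * ν ∸ 2)) (2 ^ (2 * ν ∸ 2)) G
    × TwoRank G r)
theorem4p2 ν 1≤ν .(q * 2) (divides q refl) 2ν≤r r≤ =
  graph G ,
  graph-srg G (2 ^ (2 * ν ∸ 1)) (2 ^ (2 * ν ∸ 2))
    (trans (double (2 * ν) (ℕ.≤-trans (ℕ.n≤1+n 1) 2≤2ν)) (sym order))
    (trans (cong (λ e → 2 * 2 ^ e) (sym (ℕ.∸-+-assoc (2 * ν) 1 1)))
      (double (2 * ν ∸ 1) (ℕ.∸-monoˡ-≤ 1 2≤2ν))) ,
  graph-rank G
  where
  -- Ensures that the truncated subtractions in the exponents `2 * ν ∸ 1` and `2 * ν ∸ 2` are exact.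
  2≤2ν : 2 ≤ 2 * ν
  2≤2ν = ℕ.*-monoʳ-≤ 2 1≤ν

  double : ∀ e → 1 ≤ e → 2 * 2 ^ (e ∸ 1) ≡ 2 ^ e
  double (suc e) _ = refl

  order : suc (2 ^ (2 * ν) ∸ 1) ≡ 2 ^ (2 * ν)
  order = ℕ.m+[n∸m]≡n (ℕ.m^n>0 2 (2 * ν))

  ν≤q : ν ≤ q
  ν≤q = ℕ.*-cancelˡ-≤ 2 (subst (2 * ν ≤_) (ℕ.*-comm q 2) 2ν≤r)

  q≤ : q ≤ ν + 6 * (ν / 3)
  q≤ = ℕ.*-cancelˡ-≤ 2 (subst₂ _≤_ (ℕ.*-comm q 2)
    (solve 2 (λ ν t → con 2 :* ν :+ con 12 :* t := con 2 :* (ν :+ con 6 :* t)) refl ν (ν / 3)) r≤)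
    where open +-*-Solver

  rank-eq : 2 * ν + 2 * (q ∸ ν) ≡ q * 2
  rank-eq = trans (sym (ℕ.*-distribˡ-+ 2 ν (q ∸ ν)))
    (trans (cong (2 *_) (ℕ.m+[n∸m]≡n ν≤q)) (ℕ.*-comm 2 q))

  -- The order must be a successor for a vertex to be deleted. The rank `q * 2` exceeds the minimum
  -- `2 * ν` by `q ∸ ν` increments of 2.
  G : Graphical (suc (2 ^ (2 * ν) ∸ 1)) (q * 2)
  G = subst₂ Graphical (trans (ℕ.^-*-assoc 2 2 ν) (sym order)) rank-eq
    (family ν (q ∸ ν) (ℕ.m≤n+o⇒m∸n≤o q ν q≤))
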